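{- Let $m,k$ be positive integers with $k\ge 3$. If $k>m$, then $\chi(mk,k)=2$.
   Context: For positive integers $k,N,d$ with $k\ge 3$, a $k$-term cyclic arithmetic progression mod $N$ with common difference $d$ is a $k$-element subset of $\mathbb{Z}_N=\mathbb{Z}/N\mathbb{Z}$ of the form $\{t,t+d,\ldots,t+(k-1)d\}$ for some $t\in\mathbb{Z}_N$ (so these $k$ elements are pairwise distinct mod $N$). $\chi(N,k)$ denotes the minimum number of subsets necessary to partition $\mathbb{Z}_N$ such that no subset in the partition contains any $k$-term cyclic arithmetic progression mod $N$. -}

module Defs where

open import Data.Nat using (ℕ; _+_; _*_; _≤_)
open import Data.Nat.Properties using (≤-antisym)
open import Data.Nat.DivMod using (_mod_)
open import Data.Fin using (Fin; toℕ)
open import Data.Fin.Properties using (nonZeroIndex)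
open import Data.Fin.Subset using (Subset; _∈_; _⊆_; ∣_∣; Nonempty)
open import Data.Product using (∃; ∃-syntax; _×_; _,_)
open import Function.Bundles using (_⇔_)
open import Relation.Binary.PropositionalEquality using (_≡_)
open import Relation.Nullary using (¬_)

-- ℤ/Nℤ is represented by Fin N.  This is the residue t + i d mod N; the
-- modulus is nonzero because Fin N is inhabited by t.
term : ∀ {N} → Fin N → ℕ → ℕ → Fin N
term {N} t d i = _mod_ (toℕ t + i * d) N {{nonZeroIndex t}}

-- The size condition is what makes the k listed residues pairwise distinct.
record IsCyclicAP {N} (k d : ℕ) (S : Subset N) : Set where
  field
    start   : Fin N
    members : ∀ x → x ∈ S ⇔ (∃[ i ] x ≡ term start d (toℕ {k} i))
    size    : ∣ S ∣ ≡ k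

ContainsCyclicAP : ∀ {N} → ℕ → Subset N → Set
ContainsCyclicAP {N} k A =
  ∃[ d ] 1 ≤ d × ∃[ S ] IsCyclicAP {N} k d S × S ⊆ A

record IsPartition {N r} (P : Fin r → Subset N) : Set where
  field
    nonempty : ∀ i → Nonempty (P i)
    disjoint : ∀ {i j x} → x ∈ P i → x ∈ P j → i ≡ j
    covers   : ∀ x → ∃[ i ] x ∈ P i

APFreePartition : (N k r : ℕ) → Set
APFreePartition N k r =
  ∃ λ (P : Fin r → Subset N) →
    IsPartition P × (∀ i → ¬ ContainsCyclicAP k (P i))

-- χ[ N , k ]≡ r is the equation χ(N,k) = r: the minimum number of parts of
-- an AP-free partition is attained at r.
χ[_,_]≡_ : (N k r : ℕ) → Set
χ[ N , k ]≡ r =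
  APFreePartition N k r × (∀ s → APFreePartition N k s → r ≤ s)

χ-unique : ∀ {N k r s} → χ[ N , k ]≡ r → χ[ N , k ]≡ s → r ≡ s
χ-unique (p , p-least) (q , q-least) = ≤-antisym (p-least _ q) (q-least _ p)

{-# OPTIONS --safe #-}
-- Split the residues mod k into the lower half [0,⌊k/2⌋) and the upper half,
-- and colour x ∈ ℤ/mk by the half containing x mod k.  A k-term progression
-- with k ∣ d takes at most m < k values, so it is degenerate.  Otherwise
-- e = gcd d k is a proper divisor of k and the progression meets every residue
-- mod k congruent to its start mod e; among these, the least is below
-- e ≤ k/2 and the greatest is at least k - e ≥ k/2, so both colours occur.
module Submission where

open import Data.Nat using
  (ℕ; zero; suc; _+_; _*_; _≤_; _<_; _<?_; z≤n; s≤s; z<s; NonZero; ⌊_/2⌋)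
open import Data.Nat.Properties hiding (_≟_)
open import Data.Nat.DivMod
open import Data.Nat.Divisibility using (_∣_; divides; n∣m*n)
open import Data.Nat.GCD using (GCD; module GCD; mkGCD; module Bézout)
open import Data.Nat.Tactic.RingSolver using (solve-∀)
open import Data.Bool using (if_then_else_)
open import Data.Fin using (Fin; zero; suc; toℕ; fromℕ<)
open import Data.Fin.Properties using (toℕ-fromℕ<; toℕ-injective; toℕ<n; nonZeroIndex; _≟_)
open import Data.Fin.Subset using (Subset; inside; outside; _∈_; _⊆_; ∣_∣; _∪_; ⁅_⁆; ⊥)
open import Data.Fin.Subset.Properties using
  (p⊆q⇒∣p∣≤∣q∣; ∣⊥∣≡0; ∣⁅x⁆∣≡1; x∈p∪q⁺; x∈⁅x⁆)
open import Data.Product using (∃-syntax; _×_; _,_; proj₁; proj₂)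
open import Data.Sum using (inj₁; inj₂)
open import Data.Vec using ([]; _∷_; tabulate)
open import Data.Vec.Properties using (lookup∘tabulate; []=⇒lookup; lookup⇒[]=)
open import Function using (_∘_)
open import Function.Bundles using (module Equivalence; mk⇔)
open import Level using (Level)
open import Relation.Binary.PropositionalEquality
open import Relation.Nullary using (¬_; yes; no; does; contradiction)
open import Relation.Nullary.Decidable using (dec-true; dec-false)
open import Relation.Unary using (Pred; Decidable)
open import Defs

private
  variable
    ℓ : Level
    N R : ℕ

-- Subsets of `Fin N` and bounds on their size.

fromPredicate : {P : Pred (Fin N) ℓ} → Decidable P → Subset N
fromPredicate P? = tabulate (does ∘ P?)

module _ {P : Pred (Fin N) ℓ} (P? : Decidable P) where

  ∈-fromPredicate⁺ : ∀ {x} → P x → x ∈ fromPredicate P?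
  ∈-fromPredicate⁺ {x} px = lookup⇒[]= x _
    (trans (lookup∘tabulate (does ∘ P?) x) (dec-true (P? x) px))

  ∈-fromPredicate⁻ : ∀ {x} → x ∈ fromPredicate P? → P x
  ∈-fromPredicate⁻ {x} x∈ with P? x | trans (sym (lookup∘tabulate (does ∘ P?) x)) ([]=⇒lookup x∈)
  ... | yes px | _  = px
  ... | no  _  | ()

∣p∪q∣≤∣p∣+∣q∣ : (p q : Subset N) → ∣ p ∪ q ∣ ≤ ∣ p ∣ + ∣ q ∣
∣p∪q∣≤∣p∣+∣q∣ []            []            = z≤n
∣p∪q∣≤∣p∣+∣q∣ (outside ∷ p) (outside ∷ q) = ∣p∪q∣≤∣p∣+∣q∣ p q
∣p∪q∣≤∣p∣+∣q∣ (outside ∷ p) (inside  ∷ q) =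
  ≤-trans (s≤s (∣p∪q∣≤∣p∣+∣q∣ p q)) (≤-reflexive (sym (+-suc ∣ p ∣ ∣ q ∣)))
∣p∪q∣≤∣p∣+∣q∣ (inside  ∷ p) (outside ∷ q) = s≤s (∣p∪q∣≤∣p∣+∣q∣ p q)
∣p∪q∣≤∣p∣+∣q∣ (inside  ∷ p) (inside  ∷ q) =
  s≤s (≤-trans (∣p∪q∣≤∣p∣+∣q∣ p q) (+-monoʳ-≤ ∣ p ∣ (n≤1+n ∣ q ∣)))

-- Built as a union of singletons, so that the size bound follows from subadditivity even when `f`
-- repeats values.
image : (n : ℕ) → (Fin n → Fin N) → Subset N
image zero    f = ⊥
image (suc n) f = ⁅ f zero ⁆ ∪ image n (f ∘ suc)

∈-image : ∀ n (f : Fin n → Fin N) i → f i ∈ image n f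
∈-image (suc n) f zero    = x∈p∪q⁺ (inj₁ (x∈⁅x⁆ (f zero)))
∈-image (suc n) f (suc i) = x∈p∪q⁺ (inj₂ (∈-image n (f ∘ suc) i))

∣image∣≤ : ∀ n (f : Fin n → Fin N) → ∣ image n f ∣ ≤ n
∣image∣≤ {N} zero f = ≤-reflexive (∣⊥∣≡0 N)
∣image∣≤ (suc n) f = ≤-trans (∣p∪q∣≤∣p∣+∣q∣ ⁅ f zero ⁆ _)
  (+-mono-≤ (≤-reflexive (∣⁅x⁆∣≡1 (f zero))) (∣image∣≤ n (f ∘ suc)))

∣fromPredicate-<∣ : ∀ {N k} → k ≤ N → ∣ fromPredicate {N} (λ x → toℕ x <? k) ∣ ≡ k
∣fromPredicate-<∣ {zero}  {zero}  _         = refl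
∣fromPredicate-<∣ {suc N} {zero}  _         = ∣fromPredicate-<∣ {N} z≤n
∣fromPredicate-<∣ {suc N} {suc k} (s≤s k≤N) = cong suc (∣fromPredicate-<∣ k≤N)

-- Residues of a progression mod `k`.

toℕ-term : .{{_ : NonZero N}} (t : Fin N) (d i : ℕ) → toℕ (term t d i) ≡ (toℕ t + i * d) % N
toℕ-term t d i = toℕ-fromℕ< _

-- Only a congruence mod k is claimed, hence the multiples of k on both sides:
-- the multiplier of d must be a natural number whatever the sign in Bézout's identity.
bézout-mod : ∀ {d k e} .{{_ : NonZero k}} → GCD d k e →
             ∃[ x ] ∃[ a ] ∃[ b ] x * d + a * k ≡ e + b * k
bézout-mod {d} {k@(suc k′)} {e} g with Bézout.identity g
... | Bézout.+- x y eq = x , 0 , y , trans (+-identityʳ (x * d)) (sym eq)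
-- Here `- x` is the multiplier wanted; as `k′ = k - 1`, the natural number `k′ * x` is congruent to
-- it mod `k`.
... | Bézout.-+ x y eq = k′ * x , e , k′ * y , (begin
    k′ * x * d + e * k         ≡⟨ regroup k′ x d e ⟩
    e + k′ * (e + x * d)       ≡⟨ cong (λ z → e + k′ * z) eq ⟩
    e + k′ * (y * k)           ≡⟨ cong (e +_) (*-assoc k′ y k) ⟨
    e + k′ * y * k             ∎)
  where
  open ≡-Reasoning
  regroup : ∀ k′ x d e → k′ * x * d + e * suc k′ ≡ e + k′ * (e + x * d)
  regroup = solve-∀

-- The multiples of `d` mod `k` are exactly those of `e`, so the walk from `t` fills its whole class
-- mod `e`. The index can be reduced mod `k`, because `k` steps of `d` change nothing mod `k`.
meets-residue : ∀ {d k e f} .{{_ : NonZero k}} .{{_ : NonZero e}} → GCD d k e → k ≡ suc f * e →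
                ∀ t s → t % e + s * e < k →
                ∃[ i ] (t + toℕ {k} i * d) % k ≡ t % e + s * e
meets-residue {d} {k} {e} {f} g k≡ t s r<k
  with x , a , b , bez ← bézout-mod g =
  fromℕ< (m%n<n i k) , (begin
    (t + toℕ (fromℕ< (m%n<n i k)) * d) % k   ≡⟨ cong (λ z → (t + z * d) % k) (toℕ-fromℕ< (m%n<n i k)) ⟩
    (t + i % k * d) % k                      ≡⟨ [m+kn]%n≡m%n _ (i / k * d) k ⟨
    (t + i % k * d + i / k * d * k) % k      ≡⟨ cong (_% k) (unreduce t (i % k) (i / k) d k) ⟩
    (t + (i % k + i / k * k) * d) % k        ≡⟨ cong (λ z → (t + z * d) % k) (m≡m%n+[m/n]*n i k) ⟨
    (t + i * d) % k                          ≡⟨ [m+kn]%n≡m%n _ (j * a) k ⟨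
    (t + j * x * d + j * a * k) % k          ≡⟨ cong (_% k) (factor t j x d a k) ⟩
    (t + j * (x * d + a * k)) % k            ≡⟨ cong (λ z → (t + j * z) % k) bez ⟩
    (t + j * (e + b * k)) % k                ≡⟨ cong (_% k) (expand t j e b k) ⟩
    (t + j * e + j * b * k) % k              ≡⟨ [m+kn]%n≡m%n _ (j * b) k ⟩
    (t + j * e) % k                          ≡⟨ cong (λ z → (z + j * e) % k) (m≡m%n+[m/n]*n t e) ⟩
    (t % e + q * e + j * e) % k              ≡⟨ cong (_% k) (collect (t % e) q e f s) ⟩
    (t % e + s * e + q * (suc f * e)) % k    ≡⟨ cong (λ z → (t % e + s * e + q * z) % k) k≡ ⟨
    (t % e + s * e + q * k) % k              ≡⟨ [m+kn]%n≡m%n _ q k ⟩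
    (t % e + s * e) % k                      ≡⟨ m<n⇒m%n≡m r<k ⟩
    t % e + s * e                            ∎)
  where
  open ≡-Reasoning
  q = t / e
  -- t + j e = (t mod e) + s e + q k
  j = q * f + s
  -- By `bez`, `x` steps of `d` advance by `e` mod `k`.
  i = j * x
  unreduce : ∀ t u v d k → t + u * d + v * d * k ≡ t + (u + v * k) * d
  unreduce = solve-∀
  factor : ∀ t j x d a k → t + j * x * d + j * a * k ≡ t + j * (x * d + a * k)
  factor = solve-∀
  expand : ∀ t j e b k → t + j * (e + b * k) ≡ t + j * e + j * b * k
  expand = solve-∀
  collect : ∀ r q e f s → r + q * e + (q * f + s) * e ≡ r + s * e + q * (suc f * e)
  collect = solve-∀

-- Since `k ∤ d`, the gcd `e` is a proper divisor of `k`, so `k = (f + 1) * e` with `f ≥ 1`. This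
-- places `⌊ k /2⌋` between `e` and `f * e`.
meets-halves : ∀ {k d} .{{_ : NonZero k}} → ¬ k ∣ d → ∀ t →
               (∃[ i ] (t + toℕ {k} i * d) % k < ⌊ k /2⌋) ×
               (∃[ i ] ⌊ k /2⌋ ≤ (t + toℕ {k} i * d) % k)
meets-halves {k@(suc _)} {d} k∤d t with mkGCD d k
... | e , g with GCD.gcd∣n g
-- Quotient 1 means `e = k`, and `e` divides `d`.
... | divides 1 k≡ =
  contradiction (subst (_∣ d) (sym (trans k≡ (*-identityˡ e))) (GCD.gcd∣m g)) k∤d
meets-halves {k@(suc _)} {d} k∤d t | zero , g | divides (suc f) k≡ =
  contradiction (trans k≡ (*-zeroʳ f)) λ ()
meets-halves {k@(suc _)} {d} k∤d t | e@(suc _) , g | divides (suc f@(suc f′)) k≡ =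
    (proj₁ low  , subst (_< ⌊ k /2⌋) (sym (proj₂ low)) low<)
  , (proj₁ high , subst (⌊ k /2⌋ ≤_) (sym (proj₂ high)) ≤high)
  where
  r = t % e

  r+fe<k : r + f * e < k
  r+fe<k = subst (r + f * e <_) (sym k≡) (+-monoˡ-< (f * e) (m%n<n t e))

  -- The extreme choices of `s`: 0 gives the least residue in the class of `t` mod `e`, and `f` the
  -- greatest.
  low = meets-residue {f = f} g k≡ t 0 (≤-<-trans (+-monoʳ-≤ r z≤n) r+fe<k)
  high = meets-residue {f = f} g k≡ t f r+fe<k

  e≤fe : e ≤ f * e
  e≤fe = m≤m+n e (f′ * e)

  -- Both bounds halve `e + e ≤ e + f * e ≤ f * e + f * e`, whose middle term is `k`; no case split
  -- on the parity of `k` arises.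
  half-≥ : e ≤ ⌊ k /2⌋
  half-≥ = subst₂ _≤_ (sym (n≡⌊n+n/2⌋ e)) (cong ⌊_/2⌋ (sym k≡)) (⌊n/2⌋-mono (+-monoʳ-≤ e e≤fe))

  half-≤ : ⌊ k /2⌋ ≤ f * e
  half-≤ = subst₂ _≤_ (cong ⌊_/2⌋ (sym k≡)) (sym (n≡⌊n+n/2⌋ (f * e))) (⌊n/2⌋-mono (+-monoˡ-≤ (f * e) e≤fe))

  low< : r + 0 < ⌊ k /2⌋
  low< = <-≤-trans (subst (_< e) (sym (+-identityʳ r)) (m%n<n t e)) half-≥

  ≤high : ⌊ k /2⌋ ≤ r + f * e
  ≤high = ≤-trans half-≤ (m≤n+m (f * e) r)

-- Progressions whose difference is a multiple of `k`.

-- If `k ∣ d`, then `m` steps of `d` add a multiple of `m * k`.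
term-periodic : ∀ {m k d} .{{_ : NonZero m}} → k ∣ d → (t : Fin (m * k)) → ∀ i →
                term t d i ≡ term t d (i % m)
term-periodic {m} {k} {d} (divides q refl) t i = toℕ-injective (begin
  toℕ (term t d i)                                         ≡⟨ toℕ-term t d i ⟩
  (toℕ t + i * d) % (m * k)                                ≡⟨ cong (λ z → (toℕ t + z * d) % (m * k)) (m≡m%n+[m/n]*n i m) ⟩
  (toℕ t + (i % m + i / m * m) * (q * k)) % (m * k)        ≡⟨ cong (_% (m * k)) (regroup (toℕ t) (i % m) (i / m) m q k) ⟩
  (toℕ t + i % m * (q * k) + i / m * q * (m * k)) % (m * k) ≡⟨ [m+kn]%n≡m%n _ (i / m * q) (m * k) ⟩
  (toℕ t + i % m * d) % (m * k)                            ≡⟨ toℕ-term t d (i % m) ⟨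
  toℕ (term t d (i % m))                                   ∎)
  where
  open ≡-Reasoning
  instance _ = nonZeroIndex t
  regroup : ∀ t u v m q k → t + (u + v * m) * (q * k) ≡ t + u * (q * k) + v * q * (m * k)
  regroup = solve-∀

-- A multiple of `k` preserves residues mod `k`, so the colouring cannot break such a progression.
-- It is excluded by size: periodicity leaves at most `m < k` values.
k∤difference : ∀ {m k d S} .{{_ : NonZero m}} → m < k → IsCyclicAP {m * k} k d S → ¬ k ∣ d
k∤difference {m} {k} {d} {S} m<k ap k∣d = <⇒≱ m<k (begin
  k                ≡⟨ size ⟨
  ∣ S ∣            ≤⟨ p⊆q⇒∣p∣≤∣q∣ S⊆image ⟩
  ∣ image m f ∣    ≤⟨ ∣image∣≤ m f ⟩
  m                ∎)
  where
  open ≤-Reasoning hiding (start)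
  open IsCyclicAP ap
  f : Fin m → Fin (m * k)
  f i = term start d (toℕ i)
  S⊆image : S ⊆ image m f
  S⊆image {x} x∈S with i , x≡ ← Equivalence.to (members x) x∈S =
    subst (_∈ image m f)
      (sym (trans x≡ (trans (term-periodic k∣d start (toℕ i))
        (cong (term start d) (sym (toℕ-fromℕ< (m%n<n (toℕ i) m)))))))
      (∈-image m f (fromℕ< (m%n<n (toℕ i) m)))

-- The two-colouring and its classes.

half : (k : ℕ) .{{_ : NonZero k}} → ℕ → Fin 2
half k n = if does (n % k <? ⌊ k /2⌋) then zero else suc zero

module _ (k : ℕ) .{{_ : NonZero k}} where

  half-lower : ∀ n → n % k < ⌊ k /2⌋ → half k n ≡ zero
  half-lower n n< rewrite dec-true (n % k <? ⌊ k /2⌋) n< = refl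

  half-upper : ∀ n → ⌊ k /2⌋ ≤ n % k → half k n ≡ suc zero
  half-upper n n≥ rewrite dec-false (n % k <? ⌊ k /2⌋) (≤⇒≯ n≥) = refl

colourClasses : (Fin N → Fin R) → Fin R → Subset N
colourClasses colour c = fromPredicate (λ x → colour x ≟ c)

colourClasses-isPartition : (colour : Fin N → Fin R) → (∀ c → ∃[ x ] colour x ≡ c) →
                            IsPartition (colourClasses colour)
colourClasses-isPartition colour onto = record
  { nonempty = λ c → proj₁ (onto c) , ∈-fromPredicate⁺ (λ x → colour x ≟ c) (proj₂ (onto c))
  ; disjoint = λ {i} {j} x∈i x∈j →
      trans (sym (∈-fromPredicate⁻ (λ x → colour x ≟ i) x∈i)) (∈-fromPredicate⁻ (λ x → colour x ≟ j) x∈j)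
  ; covers   = λ x → colour x , ∈-fromPredicate⁺ (λ y → colour y ≟ colour x) refl
  }

halves-APFree : ∀ {m k} → 1 ≤ m → m < k → APFreePartition (m * k) k 2
halves-APFree {suc _} {1} _ (s≤s ())
halves-APFree {m@(suc _)} {k@(suc (suc _))} _ m<k =
  colourClasses colour , colourClasses-isPartition colour onto , apFree
  where
  colour : Fin (m * k) → Fin 2
  colour x = half k (toℕ x)

  half<k : ⌊ k /2⌋ < k
  half<k = ⌊n/2⌋<n _

  half<mk : ⌊ k /2⌋ < m * k
  half<mk = <-≤-trans half<k (m≤n*m k m)

  onto : ∀ c → ∃[ x ] colour x ≡ c
  -- As `k ≥ 2`, `⌊ k /2⌋` is positive, so the residues 0 and `⌊ k /2⌋` represent the two classes.
  onto zero       = zero , half-lower k 0 z<s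
  onto (suc zero) = fromℕ< half<mk , half-upper k (toℕ (fromℕ< half<mk))
    (≤-reflexive (sym (trans (cong (_% k) (toℕ-fromℕ< half<mk)) (m<n⇒m%n≡m half<k))))

  apFree : ∀ c → ¬ ContainsCyclicAP k (colourClasses colour c)
  apFree c (d , _ , S , ap , S⊆) = 0≢1 (trans (sym (colour-of i zero i-lower)) (colour-of j (suc zero) j-upper))
    where
    open IsCyclicAP ap
    halves = meets-halves (k∤difference m<k ap) (toℕ start)
    i = proj₁ (proj₁ halves)
    j = proj₁ (proj₂ halves)

    -- Reduction mod `m * k` does not affect the residue mod `k`, since `k ∣ m * k`.
    reduce : ∀ i → (toℕ start + i * d) % k ≡ toℕ (term start d i) % k
    reduce i = sym (trans (cong (_% k) (toℕ-term start d i)) (m∣n⇒o%n%m≡o%m k (m * k) (toℕ start + i * d) (n∣m*n m)))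

    i-lower : colour (term start d (toℕ i)) ≡ zero
    i-lower = half-lower k (toℕ (term start d (toℕ i))) (subst (_< ⌊ k /2⌋) (reduce (toℕ i)) (proj₂ (proj₁ halves)))

    j-upper : colour (term start d (toℕ j)) ≡ suc zero
    j-upper = half-upper k (toℕ (term start d (toℕ j))) (subst (⌊ k /2⌋ ≤_) (reduce (toℕ j)) (proj₂ (proj₂ halves)))

    -- All members lie in class `c`; at `i` and at `j` this equates two distinct colours.
    colour-of : ∀ (i : Fin k) c′ → colour (term start d (toℕ i)) ≡ c′ → c ≡ c′
    colour-of i c′ eq = trans (sym (∈-fromPredicate⁻ (λ x → colour x ≟ c)
      (S⊆ (Equivalence.from (members _) (i , refl))))) eq

    0≢1 : ¬ zero ≡ suc {1} zero
    0≢1 ()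

-- At least two parts are necessary.

initialSegment-isCyclicAP : ∀ {N k} → .{{_ : NonZero k}} → k ≤ N →
                            IsCyclicAP {N} k 1 (fromPredicate (λ x → toℕ x <? k))
initialSegment-isCyclicAP {N@(suc _)} {k} k≤N = record
  { start   = zero
  ; members = λ x → mk⇔
      (λ x∈ → let x<k = ∈-fromPredicate⁻ (λ y → toℕ y <? k) x∈ in
        fromℕ< x<k , toℕ-injective (sym (trans (toℕ-start+ (fromℕ< x<k)) (toℕ-fromℕ< x<k))))
      (λ (i , x≡) → ∈-fromPredicate⁺ (λ y → toℕ y <? k)
        (subst (_< k) (sym (trans (cong toℕ x≡) (toℕ-start+ i))) (toℕ<n i)))
  ; size    = ∣fromPredicate-<∣ k≤N
  }
  where
  -- Nothing wraps around, because `i < k ≤ N`.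
  toℕ-start+ : (i : Fin k) → toℕ (term {N} zero 1 (toℕ i)) ≡ toℕ i
  toℕ-start+ i = trans (toℕ-term {N} zero 1 (toℕ i))
    (trans (cong (_% N) (*-identityʳ (toℕ i))) (m<n⇒m%n≡m (<-≤-trans (toℕ<n i) k≤N)))
initialSegment-isCyclicAP {zero} {suc _} ()

-- No parts cannot cover the residue 0, which exists as `0 < k ≤ N`; a single part is all of `Fin N`
-- and so contains the initial segment.
APFree⇒2≤ : ∀ {N k s} .{{_ : NonZero k}} → k ≤ N → APFreePartition N k s → 2 ≤ s
APFree⇒2≤ {suc _} {s = 0} k≤N (P , isP , _) with () ← proj₁ (IsPartition.covers isP zero)
APFree⇒2≤ {s = 1} k≤N (P , isP , apFree) =
  contradiction (1 , ≤-refl , _ , initialSegment-isCyclicAP k≤N , λ {x} _ → everything x) (apFree zero)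
  where
  everything : ∀ x → x ∈ P zero
  everything x with IsPartition.covers isP x
  ... | zero , x∈ = x∈
APFree⇒2≤ {zero} {suc _} {s = 0} ()
APFree⇒2≤ {s = suc (suc _)} _ _ = s≤s (s≤s z≤n)

proposition4p1 : (m k : ℕ) → 1 ≤ m → 3 ≤ k → m < k → χ[ m * k , k ]≡ 2
proposition4p1 m@(suc _) k@(suc _) 1≤m _ m<k =
  halves-APFree 1≤m m<k , λ s → APFree⇒2≤ (m≤n*m k m)
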